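{- Let $\mathrm{a}_{n,k}^{\mathrm{vl}}(132,321)$ denote the number of permutations of $\{1,\dots,n\}$ that avoid both $132$ and $321$ and have exactly $k$ valleys. Then $$\mathrm{a}_{n,k}^{\mathrm{vl}}(132,321)=\begin{cases}2,&k=0;\\ \binom{n}{2}-1,&k=1;\\ 0,&\text{otherwise}.\end{cases}$$
   Context: $\mathcal{S}_n$ is the set of permutations $\pi=\pi_1\cdots\pi_n$ of $\{1,\dots,n\}$. For $\rho\in\mathcal{S}_m$, $\pi\in\mathcal{S}_n$ contains $\rho$ if there are indices $1\le i_1<\cdots<i_m\le n$ such that $\pi_{i_a}<\pi_{i_b}$ if and only if $\rho_a<\rho_b$; otherwise $\pi$ avoids $\rho$. The number of valleys is $\mathrm{vl}(\pi)=|\{i:\pi_i>\pi_{i+1}\text{ and }\pi_{i+1}<\pi_{i+2}\}|$, where $1\le i\le n-2$.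
   Formalization: The formula is proved for n ≥ 2 only; it fails for n = 0 and n = 1, where there is one permutation with no valleys rather than 2, and the value for k = 1 would be −1. -}

module Defs where

open import Data.Fin.Base using (Fin; zero; suc; inject₁; _<_)
open import Data.Fin.Patterns using (0F; 1F; 2F)
open import Data.Fin.Permutation
  using (Permutation′; _⟨$⟩ʳ_; _≈_; transpose; reverse)
open import Data.Fin.Properties using (_<?_)
open import Data.Nat.Base using (ℕ; zero; suc; _∸_)
open import Data.Nat.Combinatorics using (_C_)
open import Data.Product.Base using (Σ-syntax; _×_; proj₁)
open import Data.Vec.Base using (_∷_; []; allFin; count; tabulate)
open import Function.Bundles using (_⇔_; Inverse)
open import Level using (Level; 0ℓ; _⊔_)
open import Relation.Binary.Bundles using (Setoid)
import Relation.Binary.Construct.On as On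
open import Relation.Binary.PropositionalEquality as ≡ using (_≡_; refl)
open import Relation.Nullary using (¬_; Dec)
open import Relation.Nullary.Decidable using (_×-dec_)

-- Positions and values are numbered from 0, so π₁⋯πₙ is the word
-- (π ⟨$⟩ʳ 0) ⋯ (π ⟨$⟩ʳ (n − 1)) with every letter decreased by one.

Contains : ∀ {m n} → Permutation′ n → Permutation′ m → Set
Contains {m} {n} π ρ =
  Σ[ ι ∈ (Fin m → Fin n) ]
    (∀ {a b} → a < b → ι a < ι b) ×
    (∀ a b → (π ⟨$⟩ʳ ι a < π ⟨$⟩ʳ ι b) ⇔ (ρ ⟨$⟩ʳ a < ρ ⟨$⟩ʳ b))

Avoids : ∀ {m n} → Permutation′ n → Permutation′ m → Set
Avoids π ρ = ¬ Contains π ρ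

p132 : Permutation′ 3
p132 = transpose 1F 2F

p321 : Permutation′ 3
p321 = reverse

_ : tabulate (p132 ⟨$⟩ʳ_) ≡ 0F ∷ 2F ∷ 1F ∷ []
_ = refl

_ : tabulate (p321 ⟨$⟩ʳ_) ≡ 2F ∷ 1F ∷ 0F ∷ []
_ = refl

-- The three positions compared are i, i + 1 and i + 2.

IsValley : ∀ {n} → Permutation′ (suc (suc n)) → Fin n → Set
IsValley π i =
  (π ⟨$⟩ʳ suc (inject₁ i) < π ⟨$⟩ʳ inject₁ (inject₁ i)) ×
  (π ⟨$⟩ʳ suc (inject₁ i) < π ⟨$⟩ʳ suc (suc i))

isValley? : ∀ {n} (π : Permutation′ (suc (suc n))) (i : Fin n) →
            Dec (IsValley π i)
isValley? π i = (_ <? _) ×-dec (_ <? _)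

vl : ∀ {n} → Permutation′ n → ℕ
vl {zero}        π = 0
vl {suc zero}    π = 0
vl {suc (suc n)} π = count (isValley? π) (allFin n)

-- Equality in the library's permutation type also compares inverses and
-- proofs, so elements are identified when they agree as functions.

permutationSetoid : ℕ → Setoid 0ℓ 0ℓ
permutationSetoid n = record
  { Carrier       = Permutation′ n
  ; _≈_           = _≈_
  ; isEquivalence = record
    { refl  = λ i → refl
    ; sym   = λ p i → ≡.sym (p i)
    ; trans = λ p q i → ≡.trans (p i) (q i)
    }
  }

Avoiders : ∀ {l m} → Permutation′ l → Permutation′ m →
           (n k : ℕ) → Setoid 0ℓ 0ℓ
Avoiders ρ σ n k = On.setoid (permutationSetoid n) (proj₁ {B = P})
  where
  P : Permutation′ n → Set
  P π = Avoids π ρ × Avoids π σ × vl π ≡ k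

infix 4 _HasCardinality_

_HasCardinality_ : ∀ {a ℓ : Level} → Setoid a ℓ → ℕ → Set (a ⊔ ℓ)
S HasCardinality m = Inverse S (≡.setoid (Fin m))

-- For 2 ≤ n, which is when the formula holds, n C 2 ≥ 1 and the
-- subtraction is not truncated.

closedForm : (n k : ℕ) → ℕ
closedForm n 0 = 2
closedForm n 1 = (n C 2) ∸ 1
closedForm n _ = 0

-- Write a for the first letter of an avoider π and p for the position of its
-- smallest letter, both counted from 0.  Avoiding 321 makes π increase before
-- position p, avoiding 132 makes it increase from p on.  Both patterns are
-- involutions, so π⁻¹, for which a and p are exchanged, has the same property.
-- Comparing the growth of π and π⁻¹ leaves only the word
--   a, …, a + p − 1, 0, …, a − 1, a + p, …, n − 1.
-- Its one possible valley is at its smallest letter, and is missing exactly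
-- when that letter is first (the identity) or last (p = n − 1, a = 1).  The
-- other pairs with 1 ≤ p, 1 ≤ a, p + a ≤ n number n C 2 − 1.
module Submission where

open import Defs
open import Data.Fin.Base as Fin using (Fin; zero; suc; inject₁; toℕ; fromℕ<; splitAt; join)
open import Data.Fin.Patterns using (0F; 1F; 2F)
open import Data.Fin.Permutation
  using (Permutation′; _⟨$⟩ʳ_; _⟨$⟩ˡ_; _≈_; permutation; flip; inverseˡ; inverseʳ)
open import Data.Fin.Properties as Fin
  using (toℕ<n; toℕ-injective; toℕ-fromℕ<; toℕ-inject₁)
open import Data.Nat.Base using (ℕ; zero; suc; _+_; _∸_; _≤_; _<_; z≤n; s≤s; s≤s⁻¹; z<s)
open import Data.Nat.Combinatorics using (_C_; nC1≡n; nCk+nC[k+1]≡[n+1]C[k+1])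
open import Data.Nat.Properties
open import Data.Product.Base using (∃-syntax; _×_; _,_; proj₁; proj₂; map₁)
open import Data.Sum.Base using (_⊎_; inj₁; inj₂)
open import Data.Vec.Base using (count; tabulate)
open import Function.Base using (_∘_; id)
open import Function.Bundles using (mk⇔; Equivalence; Injection)
open import Function.Construct.Symmetry using (inverse)
open import Function.Properties.Bijection using (Bijection⇒Inverse)
open import Function.Properties.Inverse using (↔⇒↣)
open import Level using (0ℓ)
open import Relation.Binary.Bundles using (Setoid)
open import Relation.Binary.Definitions using (tri<; tri≈; tri>)
open import Relation.Binary.PropositionalEquality
  using (_≡_; _≢_; refl; sym; trans; cong; cong₂; subst; subst₂; module ≡-Reasoning)
open import Relation.Nullary using (¬_; yes; no; contradiction)
open import Relation.Unary using (Pred; Decidable)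

private
  variable
    m n k p a i j v w : ℕ

-- Pattern avoidance as a condition on triples of positions, and its invariance under inversion.

No132 No321 : Permutation′ n → Set
No132 π = ∀ {i j k} → i Fin.< j → j Fin.< k →
  π ⟨$⟩ʳ i Fin.< π ⟨$⟩ʳ k → ¬ (π ⟨$⟩ʳ k Fin.< π ⟨$⟩ʳ j)
No321 π = ∀ {i j k} → i Fin.< j → j Fin.< k →
  π ⟨$⟩ʳ k Fin.< π ⟨$⟩ʳ j → ¬ (π ⟨$⟩ʳ j Fin.< π ⟨$⟩ʳ i)

-- One direction of the equivalence suffices: by trichotomy in `ρ`, a failure of the other would
-- give the reversed comparison in `π` or a repeated index.
contains : (π : Permutation′ n) (ρ : Permutation′ m) (ι : Fin m → Fin n) →
  (∀ {a b} → a Fin.< b → ι a Fin.< ι b) →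
  (∀ a b → ρ ⟨$⟩ʳ a Fin.< ρ ⟨$⟩ʳ b → π ⟨$⟩ʳ ι a Fin.< π ⟨$⟩ʳ ι b) →
  Contains π ρ
contains π ρ ι ι-mono ρ⇒π = ι , ι-mono , λ a b → mk⇔ (π⇒ρ a b) (ρ⇒π a b)
  where
  π⇒ρ : ∀ a b → π ⟨$⟩ʳ ι a Fin.< π ⟨$⟩ʳ ι b → ρ ⟨$⟩ʳ a Fin.< ρ ⟨$⟩ʳ b
  π⇒ρ a b lt with Fin.<-cmp (ρ ⟨$⟩ʳ a) (ρ ⟨$⟩ʳ b)
  ... | tri< ρa<ρb _ _ = ρa<ρb
  ... | tri> _ _ ρb<ρa = contradiction (ρ⇒π b a ρb<ρa) (<-asym lt)
  ... | tri≈ _ ρa≡ρb _ with refl ← Injection.injective (↔⇒↣ ρ) ρa≡ρb =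
    contradiction lt (<-irrefl refl)

triple : Fin n → Fin n → Fin n → Fin 3 → Fin n
triple i j k 0F = i
triple i j k 1F = j
triple i j k 2F = k

triple-mono : {i j k : Fin n} → i Fin.< j → j Fin.< k →
  ∀ {a b} → a Fin.< b → triple i j k a Fin.< triple i j k b
triple-mono i<j j<k {0F} {1F} _ = i<j
triple-mono i<j j<k {0F} {2F} _ = <-trans i<j j<k
triple-mono i<j j<k {1F} {2F} _ = j<k
triple-mono i<j j<k {1F} {1F} (s≤s ())
triple-mono i<j j<k {2F} {1F} (s≤s ())
triple-mono i<j j<k {2F} {2F} (s≤s (s≤s ()))

avoids⇒no132 : (π : Permutation′ n) → Avoids π p132 → No132 π
avoids⇒no132 π av {i} {j} {k} i<j j<k πi<πk πk<πj =
  av (contains π p132 (triple i j k) (triple-mono i<j j<k) order)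
  where
  order : ∀ a b → p132 ⟨$⟩ʳ a Fin.< p132 ⟨$⟩ʳ b →
    π ⟨$⟩ʳ triple i j k a Fin.< π ⟨$⟩ʳ triple i j k b
  order 0F 1F _ = <-trans πi<πk πk<πj
  order 0F 2F _ = πi<πk
  order 2F 1F _ = πk<πj
  order 1F 1F (s≤s (s≤s ()))
  order 1F 2F (s≤s ())
  order 2F 2F (s≤s ())

avoids⇒no321 : (π : Permutation′ n) → Avoids π p321 → No321 π
avoids⇒no321 π av {i} {j} {k} i<j j<k πk<πj πj<πi =
  av (contains π p321 (triple i j k) (triple-mono i<j j<k) order)
  where
  order : ∀ a b → p321 ⟨$⟩ʳ a Fin.< p321 ⟨$⟩ʳ b →
    π ⟨$⟩ʳ triple i j k a Fin.< π ⟨$⟩ʳ triple i j k b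
  order 1F 0F _ = πj<πi
  order 2F 0F _ = <-trans πk<πj πj<πi
  order 2F 1F _ = πk<πj
  order 0F 0F (s≤s (s≤s ()))
  order 0F 2F ()
  order 1F 2F ()
  order 2F 2F ()
  order 0F 1F (s≤s ())
  order 1F 1F (s≤s ())

no132⇒avoids : (π : Permutation′ n) → No132 π → Avoids π p132
no132⇒avoids π none (ι , mono , iff) =
  none (mono {0F} {1F} (s≤s z≤n)) (mono {1F} {2F} (s≤s (s≤s z≤n)))
     (Equivalence.from (iff 0F 2F) (s≤s z≤n))
     (Equivalence.from (iff 2F 1F) (s≤s (s≤s z≤n)))

no321⇒avoids : (π : Permutation′ n) → No321 π → Avoids π p321
no321⇒avoids π none (ι , mono , iff) =
  none (mono {0F} {1F} (s≤s z≤n)) (mono {1F} {2F} (s≤s (s≤s z≤n)))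
     (Equivalence.from (iff 2F 1F) (s≤s z≤n))
     (Equivalence.from (iff 1F 0F) (s≤s (s≤s z≤n)))

flip-values : (π : Permutation′ n) {x y : Fin n} → x Fin.< y →
  π ⟨$⟩ʳ (π ⟨$⟩ˡ x) Fin.< π ⟨$⟩ʳ (π ⟨$⟩ˡ y)
flip-values π = subst₂ Fin._<_ (sym (inverseʳ π)) (sym (inverseʳ π))

-- An occurrence in the inverse at positions `i < j < k` is one in `π`: the positions `σi < σk < σj`
-- carry the letters `i`, `k`, `j`.
no132-flip : (π : Permutation′ n) → No132 π → No132 (flip π)
no132-flip π none i<j j<k σi<σk σk<σj =
  none σi<σk σk<σj (flip-values π i<j) (flip-values π j<k)

no321-flip : (π : Permutation′ n) → No321 π → No321 (flip π)
no321-flip π none i<j j<k σk<σj σj<σi =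
  none σk<σj σj<σi (flip-values π i<j) (flip-values π j<k)

-- The two increasing runs around the smallest letter.

minPos : Permutation′ (suc n) → Fin (suc n)
minPos π = π ⟨$⟩ˡ zero

-- Inversion exchanges the two: p[ flip π ] and a[ π ] are definitionally equal.
p[_] a[_] : Permutation′ (suc n) → ℕ
p[ π ] = toℕ (minPos π)
a[ π ] = toℕ (π ⟨$⟩ʳ zero)

<⇒≢ᶠ : {i j : Fin n} → i Fin.< j → i ≢ j
<⇒≢ᶠ i<j refl = <-irrefl refl i<j

module _ (π : Permutation′ (suc n)) (no132 : No132 π) (no321 : No321 π) where

  positive-off-minPos : ∀ {i} → i ≢ minPos π → π ⟨$⟩ʳ minPos π Fin.< π ⟨$⟩ʳ i
  positive-off-minPos {i} i≢p rewrite inverseʳ π {zero} =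
    n≢0⇒n>0 λ πi≡0 → i≢p
      (trans (sym (inverseˡ π)) (cong (π ⟨$⟩ˡ_) (toℕ-injective {j = zero} πi≡0)))

  ≮⇒ascending : ∀ {i j} → i Fin.< j → ¬ (π ⟨$⟩ʳ j Fin.< π ⟨$⟩ʳ i) →
    π ⟨$⟩ʳ i Fin.< π ⟨$⟩ʳ j
  ≮⇒ascending i<j πj≮πi = ≤∧≢⇒< (≮⇒≥ πj≮πi)
    (<⇒≢ᶠ i<j ∘ Injection.injective (↔⇒↣ π) ∘ toℕ-injective)

  -- An inversion followed by the smallest letter would be a 321.
  ascending-before-min : ∀ {i j} → i Fin.< j → j Fin.< minPos π →
    π ⟨$⟩ʳ i Fin.< π ⟨$⟩ʳ j
  ascending-before-min i<j j<p =
    ≮⇒ascending i<j (no321 i<j j<p (positive-off-minPos (<⇒≢ᶠ j<p)))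

  -- An inversion preceded by the smallest letter would be a 132.
  ascending-from-min : ∀ {i j} → minPos π Fin.≤ i → i Fin.< j →
    π ⟨$⟩ʳ i Fin.< π ⟨$⟩ʳ j
  ascending-from-min {i} p≤i i<j with m≤n⇒m<n∨m≡n p≤i
  ... | inj₁ p<i = ≮⇒ascending i<j
    (no132 p<i i<j (positive-off-minPos (<⇒≢ᶠ (<-trans p<i i<j) ∘ sym)))
  ... | inj₂ p≡i with refl ← toℕ-injective p≡i = positive-off-minPos (<⇒≢ᶠ i<j ∘ sym)

-- A strictly increasing integer sequence gains at least one per step. The start `s` is a number and
-- its bound is conditional, so the interval may be empty, even with `s` equal to `n`.
ascending⇒growth : (g : Fin n → Fin n) (s t e : ℕ) →
  (∀ {i j} → s ≤ toℕ i → i Fin.< j → toℕ j < e → g i Fin.< g j) →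
  (∀ i → toℕ i ≡ s → toℕ i < e → t ≤ toℕ (g i)) →
  ∀ i → s ≤ toℕ i → toℕ i < e → t + toℕ i ≤ s + toℕ (g i)
ascending⇒growth g s t e asc base i s≤i i<e =
  subst₂ _≤_ (trans (+-assoc t _ s) (cong (t +_) (m∸n+n≡m s≤i))) (+-comm _ s)
    (+-monoˡ-≤ s (go (toℕ i ∸ s) i (sym (m+[n∸m]≡n s≤i)) i<e))
  where
  go : ∀ d i → toℕ i ≡ s + d → toℕ i < e → t + d ≤ toℕ (g i)
  go zero i i≡s i<e = subst (_≤ toℕ (g i)) (sym (+-identityʳ t))
    (base i (trans i≡s (+-identityʳ s)) i<e)
  go (suc d) i i≡s+1+d i<e = subst (_≤ toℕ (g i)) (sym (+-suc t d))
    (≤-trans (s≤s (go d i⁻ i⁻≡s+d (<-trans i⁻<i i<e))) (asc s≤i⁻ i⁻<i i<e))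
    where
    s+d<i : s + d < toℕ i
    s+d<i = ≤-reflexive (trans (sym (+-suc s d)) (sym i≡s+1+d))
    i⁻ = fromℕ< (<-trans s+d<i (toℕ<n i))
    i⁻≡s+d : toℕ i⁻ ≡ s + d
    i⁻≡s+d = toℕ-fromℕ< _
    i⁻<i : i⁻ Fin.< i
    i⁻<i = subst (_< toℕ i) (sym i⁻≡s+d) s+d<i
    s≤i⁻ : s ≤ toℕ i⁻
    s≤i⁻ = subst (s ≤_) (sym i⁻≡s+d) (m≤m+n s d)

-- The words obtained by exchanging two blocks, and their inversions.

rot : (p a i : ℕ) → ℕ
rot p a i with i <? p | i <? p + a
... | yes _ | _     = a + i
... | no _  | yes _ = i ∸ p
... | no _  | no _  = i

-- The graph of `rot`, written with sums in place of truncated subtraction. Exchanging `p` with `a`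
-- and `i` with `v` swaps `up` and `down`, so inverting the word is a relabelling.
data Rot (p a i v : ℕ) : Set where
  up   : i < p     → v ≡ a + i → Rot p a i v
  down : v < a     → i ≡ p + v → Rot p a i v
  stay : p + a ≤ i → v ≡ i     → Rot p a i v

rot-view : ∀ p a i → Rot p a i (rot p a i)
rot-view p a i with i <? p | i <? p + a
... | yes i<p | _        = up i<p refl
... | no i≮p  | yes i<p+a =
  down (+-cancelˡ-< p _ _ (subst (_< p + a) (sym (m+[n∸m]≡n (≮⇒≥ i≮p))) i<p+a))
       (sym (m+[n∸m]≡n (≮⇒≥ i≮p)))
... | no _    | no i≮p+a = stay (≮⇒≥ i≮p+a) refl

-- The three constructors place `i` in disjoint intervals, so all cases off the diagonal are
-- contradictory.
Rot⇒rot : Rot p a i v → v ≡ rot p a i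
Rot⇒rot {p} {a} {i} {v} r with i <? p | i <? p + a | r
... | yes _   | _         | up _ v≡         = v≡
... | yes i<p | _         | down _ refl     = contradiction i<p (m+n≮m p v)
... | yes i<p | _         | stay p+a≤i _    = contradiction (≤-trans (m≤m+n p a) p+a≤i) (<⇒≱ i<p)
... | no i≮p  | _         | up i<p _        = contradiction i<p i≮p
... | no _    | yes _     | down _ refl     = sym (m+n∸m≡n p v)
... | no _    | yes i<p+a | stay p+a≤i _    = contradiction p+a≤i (<⇒≱ i<p+a)
... | no _    | no i≮p+a  | down v<a refl   = contradiction (+-monoʳ-< p v<a) i≮p+a
... | no _    | no _      | stay _ v≡i      = v≡i

Rot-sym : Rot p a i v → Rot a p v i
Rot-sym (up i<p v≡)              = down i<p v≡
Rot-sym (down v<a i≡)            = up v<a i≡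
Rot-sym {p} {a} (stay p+a≤i refl) = stay (≤-trans (≤-reflexive (+-comm a p)) p+a≤i) refl

rot-involutive : ∀ p a i → rot a p (rot p a i) ≡ i
rot-involutive p a i = sym (Rot⇒rot (Rot-sym (rot-view p a i)))

Rot-bound : p + a ≤ n → i < n → Rot p a i v → v < n
Rot-bound {p} {a} {n} p+a≤n i<n (up i<p refl) =
  <-≤-trans (+-monoʳ-< a i<p) (subst (_≤ n) (+-comm p a) p+a≤n)
Rot-bound {p} {a} p+a≤n i<n (down v<a _) = <-≤-trans v<a (≤-trans (m≤n+m a p) p+a≤n)
Rot-bound p+a≤n i<n (stay _ refl) = i<n

-- Each block is increasing and the third lies above the other two, so only the first block against
-- the second is out of order.
Rot-inversion : i < j → Rot p a i v → Rot p a j w → w < v → i < p × p ≤ j × w < a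
Rot-inversion {a = a} i<j (up _ refl) (up _ refl) w<v =
  contradiction (+-monoʳ-< a i<j) (<-asym w<v)
Rot-inversion {p = p} i<j (up i<p _) (down w<a refl) w<v = i<p , m≤m+n p _ , w<a
Rot-inversion {p = p} {a} i<j (up i<p refl) (stay p+a≤j refl) w<v =
  contradiction (<-≤-trans (+-monoʳ-< a i<p) (≤-trans (≤-reflexive (+-comm a p)) p+a≤j))
    (<-asym w<v)
Rot-inversion {p = p} i<j (down _ refl) (up j<p _) w<v =
  contradiction (<-trans i<j j<p) (m+n≮m p _)
Rot-inversion {p = p} i<j (down _ refl) (down _ refl) w<v =
  contradiction (+-cancelˡ-< p _ _ i<j) (<-asym w<v)
Rot-inversion {p = p} {a} i<j (down v<a _) (stay p+a≤j refl) w<v =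
  contradiction (<-≤-trans v<a (≤-trans (m≤n+m a p) p+a≤j)) (<-asym w<v)
Rot-inversion {p = p} {a} i<j (stay p+a≤i refl) (up j<p _) w<v =
  contradiction (≤-trans (m≤m+n p a) p+a≤i) (<⇒≱ (<-trans i<j j<p))
Rot-inversion {p = p} {a} i<j (stay p+a≤i refl) (down w<a refl) w<v =
  contradiction p+a≤i (<⇒≱ (<-trans i<j (+-monoʳ-< p w<a)))
Rot-inversion i<j (stay _ refl) (stay _ refl) w<v = contradiction i<j (<-asym w<v)

rotFin : ∀ p a → p + a ≤ n → Fin n → Fin n
rotFin p a p+a≤n i = fromℕ< (Rot-bound p+a≤n (toℕ<n i) (rot-view p a (toℕ i)))

toℕ-rotFin : ∀ p a (p+a≤n : p + a ≤ n) (i : Fin n) → toℕ (rotFin p a p+a≤n i) ≡ rot p a (toℕ i)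
toℕ-rotFin _ _ _ i = toℕ-fromℕ< _

rotFin-involutive : ∀ p a (p+a≤n : p + a ≤ n) (a+p≤n : a + p ≤ n) (i : Fin n) →
  rotFin a p a+p≤n (rotFin p a p+a≤n i) ≡ i
rotFin-involutive p a p+a≤n a+p≤n i = toℕ-injective
  (trans (toℕ-rotFin a p a+p≤n _)
  (trans (cong (rot a p) (toℕ-rotFin p a p+a≤n i)) (rot-involutive p a (toℕ i))))

rotation : ∀ p a → p + a ≤ n → Permutation′ n
rotation {n} p a p+a≤n = permutation (rotFin p a p+a≤n) (rotFin a p a+p≤n)
  (rotFin-involutive a p a+p≤n p+a≤n) (rotFin-involutive p a p+a≤n a+p≤n)
  where a+p≤n = subst (_≤ n) (+-comm p a) p+a≤n

module _ (p a : ℕ) (p+a≤n : p + a ≤ n) where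

  rotation-view : ∀ i → Rot p a (toℕ i) (toℕ (rotation p a p+a≤n ⟨$⟩ʳ i))
  rotation-view i = subst (Rot p a (toℕ i)) (sym (toℕ-rotFin p a p+a≤n i)) (rot-view p a (toℕ i))

  -- The inversion `j`, `k` puts `j` in the first block and the letter at `k` below `a`. Then `i` is
  -- in the first block too, where letters are at least `a`.
  rotation-no132 : No132 (rotation p a p+a≤n)
  rotation-no132 {i} {j} {k} i<j j<k πi<πk πk<πj
    with j<p , _ , πk<a ← Rot-inversion j<k (rotation-view j) (rotation-view k) πk<πj
    with rotation-view i
  ... | up _ πi≡a+i = <⇒≱ (<-trans πi<πk πk<a) (subst (a ≤_) (sym πi≡a+i) (m≤m+n a _))
  ... | down _ i≡p+v = m+n≮m p _ (subst (_< p) i≡p+v (<-trans i<j j<p))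
  ... | stay p+a≤i _ = <⇒≱ (<-trans i<j j<p) (≤-trans (m≤m+n p a) p+a≤i)

  -- Two consecutive inversions would put `j` both inside the first block and beyond it.
  rotation-no321 : No321 (rotation p a p+a≤n)
  rotation-no321 {i} {j} {k} i<j j<k πk<πj πj<πi
    with j<p , _ ← Rot-inversion j<k (rotation-view j) (rotation-view k) πk<πj
    with _ , p≤j , _ ← Rot-inversion i<j (rotation-view i) (rotation-view j) πj<πi =
      <⇒≱ j<p p≤j

-- Every avoider is one of these words.

module _ (π : Permutation′ (suc n)) (no132 : No132 π) (no321 : No321 π) where

  lower-before-min : ∀ i → i Fin.< minPos π → a[ π ] + toℕ i ≤ toℕ (π ⟨$⟩ʳ i)
  lower-before-min i = ascending⇒growth (π ⟨$⟩ʳ_) 0 a[ π ] p[ π ]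
    (λ _ → ascending-before-min π no132 no321)
    (λ { zero refl _ → ≤-refl }) i z≤n

  upper-from-min : ∀ i → minPos π Fin.≤ i → toℕ i ≤ p[ π ] + toℕ (π ⟨$⟩ʳ i)
  upper-from-min i p≤i = ascending⇒growth (π ⟨$⟩ʳ_) p[ π ] 0 (suc n)
    (λ p≤i i<j _ → ascending-from-min π no132 no321 p≤i i<j)
    (λ _ _ _ → z≤n) i p≤i (toℕ<n i)

-- Abstracting over `π` afresh makes the preceding bounds available for `flip π` as well.
module _ (π : Permutation′ (suc n)) (no132 : No132 π) (no321 : No321 π) where

  -- The lower bound puts the letter at `i` at or above `a[ π ]`, which is the position of the
  -- smallest letter of the inverse. There `upper-from-min` for the inverse gives the matching upper
  -- bound.
  value-before-min : ∀ i → i Fin.< minPos π → toℕ (π ⟨$⟩ʳ i) ≡ a[ π ] + toℕ i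
  value-before-min i i<p = ≤-antisym
    (subst (λ x → toℕ (π ⟨$⟩ʳ i) ≤ a[ π ] + toℕ x) (inverseˡ π)
      (upper-from-min (flip π) (no132-flip π no132) (no321-flip π no321)
        (π ⟨$⟩ʳ i) (≤-trans (m≤m+n a[ π ] _) low)))
    low
    where low = lower-before-min π no132 no321 i i<p

module _ (π : Permutation′ (suc n)) (no132 : No132 π) (no321 : No321 π) where

  position-below-first : ∀ v → v Fin.< π ⟨$⟩ʳ zero → toℕ (π ⟨$⟩ˡ v) ≡ p[ π ] + toℕ v
  position-below-first = value-before-min (flip π) (no132-flip π no132) (no321-flip π no321)

  -- All smaller letters sit at earlier positions: those below `a[ π ]` by `position-below-first`,
  -- the next `p[ π ]` by `value-before-min`.
  tail-stable : ∀ i → p[ π ] + a[ π ] ≤ toℕ i → p[ π ] + a[ π ] ≤ toℕ (π ⟨$⟩ʳ i)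
  tail-stable i p+a≤i with toℕ (π ⟨$⟩ʳ i) <? a[ π ] | toℕ (π ⟨$⟩ʳ i) <? a[ π ] + p[ π ]
  ... | no _ | no πi≮a+p = ≤-trans (≤-reflexive (+-comm p[ π ] a[ π ])) (≮⇒≥ πi≮a+p)
  ... | yes πi<a | _ = contradiction
    (subst (_< p[ π ] + a[ π ])
      (trans (sym (position-below-first _ πi<a)) (cong toℕ (inverseˡ π)))
      (+-monoʳ-< p[ π ] πi<a))
    (≤⇒≯ p+a≤i)
  ... | no πi≮a | yes πi<a+p = contradiction
    (subst (_< p[ π ]) (cong toℕ j≡i) j<p)
    (≤⇒≯ (≤-trans (m≤m+n p[ π ] a[ π ]) p+a≤i))
    where
    a+d≡πi : a[ π ] + (toℕ (π ⟨$⟩ʳ i) ∸ a[ π ]) ≡ toℕ (π ⟨$⟩ʳ i)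
    a+d≡πi = m+[n∸m]≡n (≮⇒≥ πi≮a)
    d<p : toℕ (π ⟨$⟩ʳ i) ∸ a[ π ] < p[ π ]
    d<p = +-cancelˡ-< a[ π ] _ _ (subst (_< a[ π ] + p[ π ]) (sym a+d≡πi) πi<a+p)
    -- The position before the smallest letter that already carries the letter found at `i`.
    j′ : Fin (suc n)
    j′ = fromℕ< (<-trans d<p (toℕ<n (minPos π)))
    j≡d : toℕ j′ ≡ toℕ (π ⟨$⟩ʳ i) ∸ a[ π ]
    j≡d = toℕ-fromℕ< _
    j<p : toℕ j′ < p[ π ]
    j<p = subst (_< p[ π ]) (sym j≡d) d<p
    j≡i : j′ ≡ i
    j≡i = Injection.injective (↔⇒↣ π) (toℕ-injective
      (trans (value-before-min π no132 no321 j′ j<p) (trans (cong (a[ π ] +_) j≡d) a+d≡πi)))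

  tail-lower : ∀ i → p[ π ] + a[ π ] ≤ toℕ i → i Fin.≤ π ⟨$⟩ʳ i
  tail-lower i p+a≤i = +-cancelˡ-≤ (p[ π ] + a[ π ]) _ _
    (ascending⇒growth (π ⟨$⟩ʳ_) (p[ π ] + a[ π ]) (p[ π ] + a[ π ]) (suc n)
      (λ p+a≤i i<j _ → ascending-from-min π no132 no321
        (≤-trans (m≤m+n p[ π ] a[ π ]) p+a≤i) i<j)
      (λ i i≡p+a _ → tail-stable i (≤-reflexive (sym i≡p+a)))
      i p+a≤i (toℕ<n i))

module _ (π : Permutation′ (suc n)) (no132 : No132 π) (no321 : No321 π) where

  -- The upper bound is `tail-lower` for the inverse at the letter of `i`, which `tail-stable` keeps
  -- in the tail.
  tail-fixed : ∀ i → p[ π ] + a[ π ] ≤ toℕ i → toℕ (π ⟨$⟩ʳ i) ≡ toℕ i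
  tail-fixed i p+a≤i = ≤-antisym
    (subst (π ⟨$⟩ʳ i Fin.≤_) (inverseˡ π)
      (tail-lower (flip π) (no132-flip π no132) (no321-flip π no321) (π ⟨$⟩ʳ i)
        (≤-trans (≤-reflexive (+-comm a[ π ] p[ π ])) (tail-stable π no132 no321 i p+a≤i))))
    (tail-lower π no132 no321 i p+a≤i)

  avoider-view : ∀ i → Rot p[ π ] a[ π ] (toℕ i) (toℕ (π ⟨$⟩ʳ i))
  avoider-view i with toℕ i <? p[ π ] | toℕ i <? p[ π ] + a[ π ]
  ... | yes i<p | _ = up i<p (value-before-min π no132 no321 i i<p)
  ... | no _ | no i≮p+a = stay (≮⇒≥ i≮p+a) (tail-fixed i (≮⇒≥ i≮p+a))
  ... | no i≮p | yes i<p+a = down (subst (_< a[ π ]) (sym πi≡d) d<a)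
      (trans (sym p+d≡i) (cong (p[ π ] +_) (sym πi≡d)))
    where
    p+d≡i : p[ π ] + (toℕ i ∸ p[ π ]) ≡ toℕ i
    p+d≡i = m+[n∸m]≡n (≮⇒≥ i≮p)
    d<a : toℕ i ∸ p[ π ] < a[ π ]
    d<a = +-cancelˡ-< p[ π ] _ _ (subst (_< p[ π ] + a[ π ]) (sym p+d≡i) i<p+a)
    -- The letter expected at `i`; the inverse places it there.
    v′ : Fin (suc n)
    v′ = fromℕ< (<-trans d<a (toℕ<n (π ⟨$⟩ʳ zero)))
    v≡d : toℕ v′ ≡ toℕ i ∸ p[ π ]
    v≡d = toℕ-fromℕ< _
    σv≡i : π ⟨$⟩ˡ v′ ≡ i
    σv≡i = toℕ-injective (trans
      (position-below-first π no132 no321 v′ (subst (_< a[ π ]) (sym v≡d) d<a))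
      (trans (cong (p[ π ] +_) v≡d) p+d≡i))
    πi≡d : toℕ (π ⟨$⟩ʳ i) ≡ toℕ i ∸ p[ π ]
    πi≡d = trans (cong toℕ (trans (cong (π ⟨$⟩ʳ_) (sym σv≡i)) (inverseʳ π))) v≡d

  -- If `p[ π ]` is positive, the position just before the smallest letter carries
  -- `a[ π ] + p[ π ] - 1`, which is less than the length.
  avoider-bound : p[ π ] + a[ π ] ≤ suc n
  avoider-bound = bound p[ π ] refl
    where
    bound : ∀ p → p ≡ p[ π ] → p + a[ π ] ≤ suc n
    bound zero    _   = <⇒≤ (toℕ<n (π ⟨$⟩ʳ zero))
    bound (suc q) 1+q≡p = subst (_< suc n)
      (trans (value-before-min π no132 no321 last (subst (_< p[ π ]) (sym last≡q) q<p))
        (trans (cong (a[ π ] +_) last≡q) (+-comm a[ π ] q)))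
      (toℕ<n (π ⟨$⟩ʳ last))
      where
      q<p : q < p[ π ]
      q<p = ≤-reflexive 1+q≡p
      last : Fin (suc n)
      last = fromℕ< (<-trans q<p (toℕ<n (minPos π)))
      last≡q : toℕ last ≡ q
      last≡q = toℕ-fromℕ< _

p≡0⇒a≡0 : (π : Permutation′ (suc n)) → p[ π ] ≡ 0 → a[ π ] ≡ 0
p≡0⇒a≡0 π p≡0 = cong toℕ (trans
  (cong (π ⟨$⟩ʳ_) (toℕ-injective {i = zero} (sym p≡0))) (inverseʳ π))

-- Valleys of avoiders and the resulting shapes.

count-none : {A : Set} {P : Pred A 0ℓ} (P? : Decidable P) (f : Fin n → A) →
  (∀ i → ¬ P (f i)) → count P? (tabulate f) ≡ 0
count-none {zero}  P? f none = refl
count-none {suc n} P? f none with P? (f zero)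
... | yes Pf0 = contradiction Pf0 (none zero)
... | no _    = count-none P? (f ∘ suc) (none ∘ suc)

count-unique : {A : Set} {P : Pred A 0ℓ} (P? : Decidable P) (f : Fin n → A) (i : Fin n) →
  P (f i) → (∀ j → P (f j) → j ≡ i) → count P? (tabulate f) ≡ 1
count-unique P? f zero Pfi unique with P? (f zero)
... | yes _   = cong suc (count-none P? (f ∘ suc) λ j Pfj → contradiction (unique (suc j) Pfj) λ ())
... | no ¬Pf0 = contradiction Pfi ¬Pf0
count-unique P? f (suc i) Pfi unique with P? (f zero)
... | yes Pf0 = contradiction (unique zero Pf0) λ ()
... | no _    = count-unique P? (f ∘ suc) i Pfi (λ j Pfj → Fin.suc-injective (unique (suc j) Pfj))

inject₁<suc : (i : Fin n) → inject₁ i Fin.< suc i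
inject₁<suc i = s≤s (≤-reflexive (toℕ-inject₁ i))

module _ (π : Permutation′ (2 + m)) (no132 : No132 π) (no321 : No321 π) where

  -- Neither increasing run contains a descent, so a descent must lead from the first run onto the
  -- smallest letter.
  descent⇒minPos : (i : Fin (suc m)) → π ⟨$⟩ʳ suc i Fin.< π ⟨$⟩ʳ inject₁ i →
    suc (toℕ i) ≡ p[ π ]
  descent⇒minPos i descent with <-cmp (suc (toℕ i)) p[ π ]
  ... | tri≈ _ 1+i≡p _ = 1+i≡p
  ... | tri< 1+i<p _ _ = contradiction descent
    (<-asym (ascending-before-min π no132 no321 (inject₁<suc i) 1+i<p))
  ... | tri> _ _ p<1+i = contradiction descent
    (<-asym (ascending-from-min π no132 no321 p≤i (inject₁<suc i)))
    where
    p≤i : minPos π Fin.≤ inject₁ i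
    p≤i = ≤-trans (s≤s⁻¹ p<1+i) (≤-reflexive (sym (toℕ-inject₁ i)))

  valley⇒minPos : (i : Fin m) → IsValley π i → suc (toℕ i) ≡ p[ π ]
  valley⇒minPos i (descent , _) =
    trans (cong suc (sym (toℕ-inject₁ i))) (descent⇒minPos (inject₁ i) descent)

  minPos⇒valley : (i : Fin m) → suc (toℕ i) ≡ p[ π ] → IsValley π i
  minPos⇒valley i 1+i≡p =
    above (<⇒≢ᶠ (inject₁<suc (inject₁ i))) ,
    above (<⇒≢ᶠ (s≤s (inject₁<suc i)) ∘ sym)
    where
    bottom≡p : suc (inject₁ i) ≡ minPos π
    bottom≡p = toℕ-injective (trans (cong suc (toℕ-inject₁ i)) 1+i≡p)
    above : ∀ {j} → j ≢ suc (inject₁ i) → π ⟨$⟩ʳ suc (inject₁ i) Fin.< π ⟨$⟩ʳ j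
    above {j} j≢ = subst (λ x → π ⟨$⟩ʳ x Fin.< π ⟨$⟩ʳ j) (sym bottom≡p)
      (positive-off-minPos π no132 no321 (λ j≡p → j≢ (trans j≡p (sym bottom≡p))))

-- The triples (vl π , p[ π ] , a[ π ]) of the avoiders π of length 2 + m.
data Shape (m : ℕ) : (k p a : ℕ) → Set where
  identity : Shape m 0 0 0
  cycle    : Shape m 0 (suc m) 1
  peak     : p < m → suc p + suc a ≤ 2 + m → Shape m 1 (suc p) (suc a)

shape-bound : Shape m k p a → p + a ≤ 2 + m
shape-bound identity              = z≤n
shape-bound {m} cycle             = ≤-reflexive (+-comm (suc m) 1)
shape-bound (peak _ p+a≤n)        = p+a≤n

shape-exists : ∀ m p a → p < 2 + m → p + a ≤ 2 + m → (p ≡ 0 → a ≡ 0) → (a ≡ 0 → p ≡ 0) →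
  ∃[ k ] Shape m k p a
shape-exists m zero a _ _ a≡0 _ rewrite a≡0 refl = 0 , identity
shape-exists m (suc p) zero _ _ _ p≡0 = contradiction (p≡0 refl) λ ()
shape-exists m (suc p) (suc a) 1+p<2+m p+a≤n _ _ with m≤n⇒m<n∨m≡n (s≤s⁻¹ (s≤s⁻¹ 1+p<2+m))
... | inj₁ p<m = 1 , peak p<m p+a≤n
-- The smallest letter is last here, and the bound on the sum leaves only `1` as the first letter.
... | inj₂ refl with refl ← n≤0⇒n≡0 (+-cancelˡ-≤ (2 + p) a 0
        (subst₂ _≤_ (+-suc (suc p) a) (sym (+-identityʳ (2 + p))) p+a≤n)) = 0 , cycle

module _ (π : Permutation′ (2 + m)) (no132 : No132 π) (no321 : No321 π) where

  -- A valley has its bottom at the smallest letter, at position `suc (toℕ i)` with `i : Fin m`. The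
  -- positions `0` and `suc m` are not of this form; `suc p` with `p < m` is, for exactly one `i`.
  shape⇒vl : Shape m k p a → p ≡ p[ π ] → vl π ≡ k
  shape⇒vl identity p≡ = count-none (isValley? π) id
    λ i valley → contradiction (trans (valley⇒minPos π no132 no321 i valley) (sym p≡)) λ ()
  shape⇒vl cycle p≡ = count-none (isValley? π) id
    λ i valley → <⇒≢ (toℕ<n i)
      (suc-injective (trans (valley⇒minPos π no132 no321 i valley) (sym p≡)))
  shape⇒vl (peak {p} p<m _) p≡ = count-unique (isValley? π) id (fromℕ< p<m)
    (minPos⇒valley π no132 no321 _ (trans (cong suc (toℕ-fromℕ< p<m)) p≡))
    (λ j valley → toℕ-injective (suc-injective
      (trans (valley⇒minPos π no132 no321 j valley)
        (trans (sym p≡) (cong suc (sym (toℕ-fromℕ< p<m)))))))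

  vl⇒shape : Shape m (vl π) p[ π ] a[ π ]
  vl⇒shape
    with k , shape ← shape-exists m _ _ (toℕ<n (minPos π)) (avoider-bound π no132 no321)
           (p≡0⇒a≡0 π) (p≡0⇒a≡0 (flip π))
    = subst (λ k → Shape m k _ _) (sym (shape⇒vl shape refl)) shape

-- From an enumeration of pairs to one of the avoiders.

-- This recovers the pair from its word. It fails when exactly one entry is zero, as such a pair
-- also gives the identity; `Shape` excludes these pairs.
shape⇒rot-0 : Shape m k p a → rot p a 0 ≡ a × rot a p 0 ≡ p
shape⇒rot-0 identity   = refl , refl
shape⇒rot-0 cycle      = refl , cong suc (+-identityʳ _)
shape⇒rot-0 (peak _ _) = cong suc (+-identityʳ _) , cong suc (+-identityʳ _)

≈⇒minPos≡ : (π ρ : Permutation′ (suc n)) → π ≈ ρ → minPos π ≡ minPos ρ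
≈⇒minPos≡ π ρ π≈ρ = Injection.injective (↔⇒↣ ρ)
  (trans (sym (π≈ρ (minPos π))) (trans (inverseʳ π) (sym (inverseʳ ρ))))

module _ (c : Fin n → ℕ × ℕ) (c-injective : ∀ {x y} → c x ≡ c y → x ≡ y)
  (c-shape : ∀ x → Shape m k (proj₁ (c x)) (proj₂ (c x)))
  (c-surjective : ∀ {p a} → Shape m k p a → ∃[ x ] c x ≡ (p , a)) where

  private
    cₚ cₐ : Fin n → ℕ
    cₚ = proj₁ ∘ c
    cₐ = proj₂ ∘ c

    word : Fin n → Permutation′ (2 + m)
    word x = rotation (cₚ x) (cₐ x) (shape-bound (c-shape x))

    word-no132 : ∀ x → No132 (word x)
    word-no132 x = rotation-no132 (cₚ x) (cₐ x) (shape-bound (c-shape x))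

    word-no321 : ∀ x → No321 (word x)
    word-no321 x = rotation-no321 (cₚ x) (cₐ x) (shape-bound (c-shape x))

    word-first : ∀ x → a[ word x ] ≡ cₐ x
    word-first x = trans (toℕ-rotFin (cₚ x) (cₐ x) (shape-bound (c-shape x)) zero)
      (proj₁ (shape⇒rot-0 (c-shape x)))

    word-minPos : ∀ x → p[ word x ] ≡ cₚ x
    word-minPos x = trans
      (toℕ-rotFin (cₐ x) (cₚ x)
        (subst (_≤ 2 + m) (+-comm (cₚ x) (cₐ x)) (shape-bound (c-shape x))) zero)
      (proj₂ (shape⇒rot-0 (c-shape x)))

  -- Injectivity holds because first letter and position of the smallest letter determine the pair;
  -- surjectivity is `avoider-view`.
  shapes-enumerate-avoiders : Avoiders p132 p321 (2 + m) k HasCardinality n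
  shapes-enumerate-avoiders = inverse (Bijection⇒Inverse record
    { to        = λ x → word x
        , no132⇒avoids (word x) (word-no132 x)
        , no321⇒avoids (word x) (word-no321 x)
        , shape⇒vl (word x) (word-no132 x) (word-no321 x) (c-shape x) (sym (word-minPos x))
    ; cong      = λ { refl i → refl }
    ; bijective = (λ {x} {y} → injective x y) , surjective
    })
    where
    injective : ∀ x y → word x ≈ word y → x ≡ y
    injective x y wx≈wy = c-injective (cong₂ _,_
      (trans (sym (word-minPos x)) (trans (cong toℕ (≈⇒minPos≡ (word x) (word y) wx≈wy))
        (word-minPos y)))
      (trans (sym (word-first x)) (trans (cong toℕ (wx≈wy zero)) (word-first y))))

    surjective : ∀ ((π , _) : Setoid.Carrier (Avoiders p132 p321 (2 + m) k)) →
      ∃[ x ] ∀ {y} → y ≡ x → word y ≈ π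
    -- Matching `refl` turns `k` into `vl π`, the index at which `vl⇒shape` supplies a shape.
    surjective (π , av132 , av321 , refl)
      with no132 ← avoids⇒no132 π av132 | no321 ← avoids⇒no321 π av321
      with x , cx≡ ← c-surjective (vl⇒shape π no132 no321) =
      x , λ { refl i → toℕ-injective (trans (toℕ-rotFin (cₚ x) (cₐ x) (shape-bound (c-shape x)) i)
        (trans (cong (λ (p , a) → rot p a (toℕ i)) cx≡)
               (sym (Rot⇒rot (avoider-view π no132 no321 i))))) }

-- Enumeration of the pairs with one valley.

-- The pairs with p = 1 come first; decreasing p in the others gives the pairs
-- for the next smaller m.
peakCount : ℕ → ℕ
peakCount zero    = 0
peakCount (suc m) = (2 + m) + peakCount m

1+peakCount : ∀ m → suc (peakCount m) ≡ (2 + m) C 2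
1+peakCount zero    = refl
1+peakCount (suc m) = begin
  suc ((2 + m) + peakCount m)    ≡⟨ +-suc (2 + m) (peakCount m) ⟨
  (2 + m) + suc (peakCount m)    ≡⟨ cong₂ _+_ (sym (nC1≡n (2 + m))) (1+peakCount m) ⟩
  (2 + m) C 1 + (2 + m) C 2      ≡⟨ nCk+nC[k+1]≡[n+1]C[k+1] (2 + m) 1 ⟩
  (3 + m) C 2                    ∎
  where open ≡-Reasoning

-- Kept apart from `peakPair` so that injectivity reduces to that of `splitAt` and a case analysis
-- on the sum.
split : ∀ m → Fin (2 + m) ⊎ Fin (peakCount m) → ℕ × ℕ
peakPair : ∀ m → Fin (peakCount m) → ℕ × ℕ

split m (inj₁ b) = 1 , suc (toℕ b)
split m (inj₂ x) = map₁ suc (peakPair m x)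

peakPair (suc m) x = split m (splitAt (2 + m) x)

peak-shape : ∀ m x → Shape m 1 (proj₁ (peakPair m x)) (proj₂ (peakPair m x))
peak-shape (suc m) x with splitAt (2 + m) x
... | inj₁ b = peak z<s (s≤s (toℕ<n b))
... | inj₂ y with peakPair m y | peak-shape m y
...   | _ | peak p<m p+a≤n = peak (s≤s p<m) (s≤s p+a≤n)

peak-injective : ∀ m {x y} → peakPair m x ≡ peakPair m y → x ≡ y
split-injective : ∀ m {u v} → split m u ≡ split m v → u ≡ v

peak-injective (suc m) {x} {y} eq = Injection.injective (↔⇒↣ (Fin.+↔⊎ {2 + m}))
  (split-injective m {splitAt (2 + m) x} {splitAt (2 + m) y} eq)

split-injective m {inj₁ b} {inj₁ b′} eq = cong inj₁ (toℕ-injective (suc-injective (cong proj₂ eq)))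
split-injective m {inj₂ x} {inj₂ y} eq =
  cong inj₂ (peak-injective m (cong₂ _,_ (suc-injective (cong proj₁ eq)) (cong proj₂ eq)))
-- `peak-shape` exposes a successor, so the first entries are `1` on one side and at least `2` on
-- the other.
split-injective m {inj₁ b} {inj₂ y} eq with peakPair m y | peak-shape m y
split-injective m {inj₁ b} {inj₂ y} () | _ | peak _ _
split-injective m {inj₂ x} {inj₁ b} eq with peakPair m x | peak-shape m x
split-injective m {inj₂ x} {inj₁ b} () | _ | peak _ _

peak-surjective : ∀ m {p a} → Shape m 1 p a → ∃[ x ] peakPair m x ≡ (p , a)
peak-surjective (suc m) (peak {zero} {a} _ p+a≤n) =
  join (2 + m) _ (inj₁ (fromℕ< a<2+m)) ,
  trans (cong (split m) (Fin.splitAt-join (2 + m) _ (inj₁ (fromℕ< a<2+m))))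
        (cong (λ b → 1 , suc b) (toℕ-fromℕ< a<2+m))
  where a<2+m = s≤s⁻¹ p+a≤n
peak-surjective (suc m) (peak {suc p} 1+p<1+m p+a≤n)
  with y , eq ← peak-surjective m (peak (s≤s⁻¹ 1+p<1+m) (s≤s⁻¹ p+a≤n)) =
  join (2 + m) _ (inj₂ y) ,
  trans (cong (split m) (Fin.splitAt-join (2 + m) _ (inj₂ y))) (cong (map₁ suc) eq)

-- The two pairs without a valley, and the final count.

flatPair : ∀ m → Fin 2 → ℕ × ℕ
flatPair m 0F = 0 , 0
-- The word `1, 2, …, suc m, 0`, whose smallest letter is last.
flatPair m 1F = suc m , 1

flat-injective : ∀ m {x y} → flatPair m x ≡ flatPair m y → x ≡ y
flat-injective m {0F} {0F} _ = refl
flat-injective m {0F} {1F} ()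
flat-injective m {1F} {0F} ()
flat-injective m {1F} {1F} _ = refl

flat-shape : ∀ m x → Shape m 0 (proj₁ (flatPair m x)) (proj₂ (flatPair m x))
flat-shape m 0F = identity
flat-shape m 1F = cycle

flat-surjective : ∀ {p a} → Shape m 0 p a → ∃[ x ] flatPair m x ≡ (p , a)
flat-surjective identity = 0F , refl
flat-surjective cycle    = 1F , refl

proposition25 : ∀ (n k : ℕ) → 2 ≤ n →
    Avoiders p132 p321 n k HasCardinality closedForm n k
proposition25 (suc (suc m)) 0 _ =
  shapes-enumerate-avoiders (flatPair m) (flat-injective m) (flat-shape m) flat-surjective
-- The rewriting exposes `suc (peakCount m) ∸ 1`, which computes to `peakCount m`.
proposition25 (suc (suc m)) 1 _ rewrite sym (1+peakCount m) =
  shapes-enumerate-avoiders (peakPair m) (peak-injective m) (peak-shape m) (peak-surjective m)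
-- No shape has two or more valleys, so the empty enumeration is complete.
proposition25 (suc (suc m)) (suc (suc k)) _ =
  shapes-enumerate-avoiders (λ ()) (λ { {()} }) (λ ()) λ ()
proposition25 (suc zero) _ (s≤s ())
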